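{- Let $f : 2^V \to \mathbb{Z}_{\ge 0}$ be a connectivity function. If $W \subseteq V$ is a set with $f(W) > 2\,\mathtt{bw}(f)$, then there exists a tripartition $(C_1,C_2,C_3)$ of $V$ (parts may be empty) such that for each $i\in\{1,2,3\}$: $f(C_i) < f(W)/2$, $f(C_i\cap W) < f(W)$, and $f(C_i \cap (V\setminus W)) < f(W)$.
   Context: $V$ is a finite set. A function $f:2^V\to\mathbb{Z}_{\ge 0}$ is a connectivity function if $f(\emptyset)=0$, $f(X)=f(V\setminus X)$ for all $X\subseteq V$, and $f(X\cup Y)+f(X\cap Y)\le f(X)+f(Y)$ for all $X,Y\subseteq V$. A branch decomposition of $f$ is a pair $(T,L)$ where $T$ is a tree whose nodes have degree 1 or 3 and $L$ is a bijection from $V$ to the leaves of $T$ (such exist only when $|V|\ge 2$). Each edge $e$ of $T$ induces, via the components of $T-e$, a bipartition $(X,V\setminus X)$ of $V$, and its width is $f(X)$. The width of $(T,L)$ is the maximum edge width, and $\mathtt{bw}(f)$, the branchwidth of $f$, is the minimum width of a branch decomposition of $f$. A tripartition of $V$ is an ordered triple of pairwise disjoint sets (possibly empty) whose union is $V$. -}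

module Defs where

open import Data.Fin.Base using (Fin; zero; suc)
open import Data.Fin.Subset using (Subset; _∈_; _∉_; _∪_; _∩_; ∁; ⊤; ⊥; ∣_∣)
open import Data.List.Base using (List; _∷_; _∷ʳ_; length)
open import Data.List.Relation.Unary.Linked using (Linked)
open import Data.List.Relation.Unary.Unique.Propositional using (Unique)
open import Data.Nat.Base using (ℕ; _+_; _≤_; _<_)
open import Data.Product.Base using (Σ; Σ-syntax; ∃; ∃-syntax; _×_; proj₁)
open import Data.Sum.Base using (_⊎_)
open import Function.Bundles using (_⇔_; _⤖_; module Bijection)
open import Relation.Binary.Construct.Closure.ReflexiveTransitive using (Star)
open import Relation.Binary.PropositionalEquality using (_≡_; _≢_)
open import Relation.Nullary using (¬_)

record IsConnectivityFunction {n : ℕ} (f : Subset n → ℕ) : Set where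
  field
    f-⊥         : f ⊥ ≡ 0
    symmetric   : ∀ X → f X ≡ f (∁ X)
    submodular  : ∀ X Y → f (X ∪ Y) + f (X ∩ Y) ≤ f X + f Y

-- Finite simple graphs on the node set Fin m, given by neighbourhoods.
record Graph (m : ℕ) : Set where
  field
    nbrs    : Fin m → Subset m
    sym     : ∀ {s t} → t ∈ nbrs s → s ∈ nbrs t
    irrefl  : ∀ s → s ∉ nbrs s

  Adj : Fin m → Fin m → Set
  Adj s t = t ∈ nbrs s

  degree : Fin m → ℕ
  degree s = ∣ nbrs s ∣

  Leaf : Set
  Leaf = Σ[ s ∈ Fin m ] degree s ≡ 1

  -- The cycle s, t₁, …, tₖ, s is given by s and the list t₁, …, tₖ.
  IsCycle : Fin m → List (Fin m) → Set
  IsCycle s ts = 2 ≤ length ts × Unique (s ∷ ts) × Linked Adj (s ∷ ts ∷ʳ s)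

  Connected : Set
  Connected = ∀ s t → Star Adj s t

  Acyclic : Set
  Acyclic = ∀ s ts → ¬ IsCycle s ts

  -- Adjacency after deletion of the edge st.
  AdjWithout : (s t : Fin m) → Fin m → Fin m → Set
  AdjWithout s t x y = Adj x y × ¬ ((x ≡ s × y ≡ t) ⊎ (x ≡ t × y ≡ s))

record IsTree {m : ℕ} (G : Graph m) : Set where
  open Graph G
  field
    nonempty   : 0 < m
    connected  : Connected
    acyclic    : Acyclic

record BranchDecomposition (n : ℕ) : Set where
  field
    {m}     : ℕ
    T       : Graph m
    isTree  : IsTree T

  open Graph T public

  field
    degree-1-or-3  : ∀ s → degree s ≡ 1 ⊎ degree s ≡ 3
    L              : Fin n ⤖ Leaf

  leafOf : Fin n → Fin m
  leafOf v = proj₁ (Bijection.to L v)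

  -- X is the part, on the side of s, of the bipartition induced by the edge st:
  -- the elements whose leaves lie in the component of T − st containing s.
  IsSide : (s t : Fin m) → Subset n → Set
  IsSide s t X = ∀ v → v ∈ X ⇔ Star (AdjWithout s t) s (leafOf v)

  -- Each edge occurs in both orientations, so both of its sides are considered;
  -- they have the same f-value when f is symmetric.
  IsEdgeWidth : (Subset n → ℕ) → ℕ → Set
  IsEdgeWidth f w = ∃[ s ] ∃[ t ] Adj s t × (∃[ X ] IsSide s t X × f X ≡ w)

IsMaximum IsMinimum : (ℕ → Set) → ℕ → Set
IsMaximum P k = P k × (∀ j → P j → j ≤ k)
IsMinimum P k = P k × (∀ j → P j → k ≤ j)

IsWidth : ∀ {n} → (Subset n → ℕ) → BranchDecomposition n → ℕ → Set
IsWidth f D = IsMaximum (BranchDecomposition.IsEdgeWidth D f)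

-- IsBranchwidth f k says that bw(f) is defined and equal to k.  It is defined
-- only for n ≥ 2, as there are no branch decompositions for smaller n.
IsBranchwidth : ∀ {n} → (Subset n → ℕ) → ℕ → Set
IsBranchwidth {n} f = IsMinimum (λ w → Σ[ D ∈ BranchDecomposition n ] IsWidth f D w)

record Tripartition (n : ℕ) : Set where
  field
    part      : Fin 3 → Subset n
    disjoint  : ∀ i j → i ≢ j → part i ∩ part j ≡ ⊥
    covers    : part zero ∪ part (suc zero) ∪ part (suc (suc zero)) ≡ ⊤

{-# OPTIONS --safe #-}
module Submission where

-- Call X good when f (X ∩ W) and f (X ∩ ∁ W) are both smaller than f W.
-- If 2 f X < f W, then by submodularity X or ∁ X is good.  In a branch
-- decomposition of width bw, walk along edges, always into a side that is not
-- good.  The components entered strictly shrink, and the side consisting of a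
-- single leaf is good, so the walk stops at a node all of whose incident edges
-- have a good far side.  If that node has degree 3, the three far sides form
-- the tripartition; if it is a leaf, it is the node where the walk started and
-- the two sides of its edge, together with ∅, do.

open import Defs
open import Data.Empty using (⊥-elim)
open import Data.Fin.Base using (Fin; zero; suc; fromℕ<)
open import Data.Fin.Properties using (_≟_)
open import Data.Fin.Subset
  using (Subset; _∈_; _∉_; _⊆_; _∪_; _∩_; ∁; ⊥; ∣_∣; inside; outside)
open import Data.Fin.Subset.Properties
open import Data.List.Base using (List; []; _∷_; _∷ʳ_)
import Data.List.Membership.Propositional as List
open import Data.List.Relation.Unary.All.Properties using (¬Any⇒All¬)
open import Data.List.Relation.Unary.AllPairs using ([]; _∷_)
open import Data.List.Relation.Unary.All using ([])
open import Data.List.Relation.Unary.Any using (here; there)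
open import Data.List.Relation.Unary.Linked using (Linked; [-]; _∷_)
open import Data.List.Relation.Unary.Unique.Propositional using (Unique)
open import Data.Nat.Base using (ℕ; zero; suc; _+_; _*_; _≤_; _<_; _>_; z≤n; s≤s)
open import Data.Nat.Induction using (Acc; acc; <-wellFounded)
open import Data.Nat.Properties
  using (≡-irrelevant; suc-injective; _<?_; ≮⇒≥; ≤-<-trans;
         m≤m+n; +-cancelʳ-≤; +-monoʳ-≤; *-monoʳ-≤;
         module ≤-Reasoning)
open import Data.Nat.Tactic.RingSolver using (solve-∀)
open import Data.Product.Base using (Σ-syntax; ∃-syntax; _×_; _,_; proj₁; proj₂)
open import Data.Sum.Base using (_⊎_; inj₁; inj₂; [_,_]′) renaming (map to ⊎-map; swap to ⊎-swap)
open import Data.Vec.Base using ([]; _∷_; here; there; tabulate)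
open import Data.Vec.Properties using (lookup∘tabulate; []=⇒lookup; lookup⇒[]=)
open import Function.Base using (_∘_; id)
open import Function.Bundles using (_⇔_; mk⇔; module Equivalence; module Bijection)
open import Relation.Binary.Construct.Closure.ReflexiveTransitive
  using (Star; ε; _◅_; _◅◅_; reverse; map)
open import Relation.Binary.PropositionalEquality
open import Relation.Nullary using (¬_; yes; no; does; contradiction)
open import Relation.Nullary.Decidable using (_×-dec_; dec-true)
open import Relation.Unary using (Decidable)
import Algebra.Lattice.Properties.BooleanAlgebra as BooleanAlgebraProperties

open Equivalence using (to; from)

-- Subsets of a finite set.

module _ {n : ℕ} where
  open BooleanAlgebraProperties (∪-∩-booleanAlgebra n) public
    using (deMorgan₂; ¬-involutive)

-- Turns the sides of a tree edge, given by reachability, into `Subset`s: of the elements of V and,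
-- for the termination measure, of the nodes.
comprehension : ∀ {n} {P : Fin n → Set} → Decidable P →
  Σ[ X ∈ Subset n ] (∀ x → x ∈ X ⇔ P x)
comprehension {n} {P} P? = X , λ x → mk⇔ (sound x) (complete x)
  where
  X = tabulate (does ∘ P?)
  sound : ∀ x → x ∈ X → P x
  sound x x∈X with P? x | trans (sym (lookup∘tabulate (does ∘ P?) x)) ([]=⇒lookup x∈X)
  ... | yes p | _ = p
  ... | no _  | ()
  complete : ∀ x → P x → x ∈ X
  complete x p =
    lookup⇒[]= x X (trans (lookup∘tabulate (does ∘ P?) x) (dec-true (P? x) p))

empty⇒≡⊥ : ∀ {n} {X : Subset n} → (∀ x → x ∉ X) → X ≡ ⊥
empty⇒≡⊥ x∉X = Empty-unique λ (x , x∈X) → x∉X x x∈X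

∣p∣≡0⇒x∉p : ∀ {n} (p : Subset n) → ∣ p ∣ ≡ 0 → ∀ {x} → x ∉ p
∣p∣≡0⇒x∉p (outside ∷ p) eq (there x∈p) = ∣p∣≡0⇒x∉p p eq x∈p

-- Peels off one element; iterating it enumerates the neighbours of a node of degree 1 or 3, and
-- `x ∉ q` makes them distinct.
∣p∣≡1+k⇒split : ∀ {n} (p : Subset n) {k} → ∣ p ∣ ≡ suc k →
  ∃[ x ] ∃[ q ] ∣ q ∣ ≡ k × x ∉ q × x ∈ p × q ⊆ p × (∀ {y} → y ∈ p → y ≡ x ⊎ y ∈ q)
∣p∣≡1+k⇒split (inside ∷ p) eq =
  zero , outside ∷ p , suc-injective eq , (λ ()) , here ,
  (λ { (there y∈p) → there y∈p }) ,
  λ { here → inj₁ refl ; (there y∈p) → inj₂ (there y∈p) }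
∣p∣≡1+k⇒split (outside ∷ p) eq with ∣p∣≡1+k⇒split p eq
... | x , q , ∣q∣≡k , x∉q , x∈p , q⊆p , split =
  suc x , outside ∷ q , ∣q∣≡k , (λ { (there x∈q) → x∉q x∈q }) , there x∈p ,
  (λ { (there y∈q) → there (q⊆p y∈q) }) ,
  λ { (there y∈p) → ⊎-map (cong suc) there (split y∈p) }

∣p∣≡1⇒singleton : ∀ {n} (p : Subset n) → ∣ p ∣ ≡ 1 →
  ∃[ x ] x ∈ p × (∀ {y} → y ∈ p → y ≡ x)
∣p∣≡1⇒singleton p eq with ∣p∣≡1+k⇒split p eq
... | x , q , ∣q∣≡0 , _ , x∈p , _ , split =
  x , x∈p , λ y∈p → [ id , ⊥-elim ∘ ∣p∣≡0⇒x∉p q ∣q∣≡0 ]′ (split y∈p)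

∣p∣≡3⇒triple : ∀ {n} (p : Subset n) → ∣ p ∣ ≡ 3 →
  ∃[ x ] ∃[ y ] ∃[ z ] (x ∈ p × y ∈ p × z ∈ p) × (x ≢ y × x ≢ z × y ≢ z) ×
    (∀ {w} → w ∈ p → w ≡ x ⊎ w ≡ y ⊎ w ≡ z)
∣p∣≡3⇒triple p eq with ∣p∣≡1+k⇒split p eq
... | x , q , ∣q∣≡2 , x∉q , x∈p , q⊆p , splitₚ with ∣p∣≡1+k⇒split q ∣q∣≡2
... | y , r , ∣r∣≡1 , y∉r , y∈q , r⊆q , splitᵣ with ∣p∣≡1⇒singleton r ∣r∣≡1
... | z , z∈r , only =
  x , y , z , (x∈p , q⊆p y∈q , q⊆p (r⊆q z∈r)) ,
  ((λ { refl → x∉q y∈q }) , (λ { refl → x∉q (r⊆q z∈r) }) , (λ { refl → y∉r z∈r })) ,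
  ⊎-map id (⊎-map id only ∘ splitᵣ) ∘ splitₚ

-- `Q` is carried along so that the case analysis on `Fin 3` happens only here.
mkTripartition : ∀ {n} (A B C : Subset n) →
  (∀ {x} → x ∈ A → x ∉ B) → (∀ {x} → x ∈ A → x ∉ C) → (∀ {x} → x ∈ B → x ∉ C) →
  (∀ x → x ∈ A ⊎ x ∈ B ⊎ x ∈ C) →
  {Q : Subset n → Set} → Q A → Q B → Q C →
  Σ[ P ∈ Tripartition n ] (∀ i → Q (Tripartition.part P i))
mkTripartition {n} A B C A#B A#C B#C cover {Q} qA qB qC =
  record { part = part ; disjoint = disjoint ; covers = covers } , good
  where
  part : Fin 3 → Subset n
  part zero             = A
  part (suc zero)       = B
  part (suc (suc zero)) = C

  good : ∀ i → Q (part i)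
  good zero             = qA
  good (suc zero)       = qB
  good (suc (suc zero)) = qC

  ∩≡⊥ : ∀ {X Y : Subset n} → (∀ {x} → x ∈ X → x ∉ Y) → X ∩ Y ≡ ⊥
  ∩≡⊥ {X} {Y} X#Y = empty⇒≡⊥ λ x x∈ → let x∈X , x∈Y = x∈p∩q⁻ X Y x∈ in X#Y x∈X x∈Y

  disjoint : ∀ i j → i ≢ j → part i ∩ part j ≡ ⊥
  disjoint zero             zero             i≢j = contradiction refl i≢j
  disjoint zero             (suc zero)       _   = ∩≡⊥ A#B
  disjoint zero             (suc (suc zero)) _   = ∩≡⊥ A#C
  disjoint (suc zero)       zero             _   = ∩≡⊥ λ b a → A#B a b
  disjoint (suc zero)       (suc zero)       i≢j = contradiction refl i≢j
  disjoint (suc zero)       (suc (suc zero)) _   = ∩≡⊥ B#C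
  disjoint (suc (suc zero)) zero             _   = ∩≡⊥ λ c a → A#C a c
  disjoint (suc (suc zero)) (suc zero)       _   = ∩≡⊥ λ c b → B#C b c
  disjoint (suc (suc zero)) (suc (suc zero)) i≢j = contradiction refl i≢j

  covers : A ∪ B ∪ C ≡ _
  covers = ⊆-antisym ⊆⊤ λ {x} _ → x∈p∪q⁺ (⊎-map id x∈p∪q⁺ (cover x))

-- Walks and simple paths.

Star-preserves : ∀ {A : Set} {R : A → A → Set} (P : A → Set) →
  (∀ {x y} → P x → R x y → P y) → ∀ {x y} → P x → Star R x y → P y
Star-preserves P step p ε        = p
Star-preserves P step p (r ◅ rs) = Star-preserves P step (step p r) rs

module SimplePath {m : ℕ} (R : Fin m → Fin m → Set) where
  open import Data.List.Membership.DecPropositional (_≟_ {m}) using () renaming (_∈?_ to _∈ᴸ?_)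

  -- The list omits the start and includes the end, as the list in `IsCycle` does, so that closing a
  -- path yields a cycle directly.
  Path : Fin m → List (Fin m) → Fin m → Set
  Path x []       y = x ≡ y
  Path x (z ∷ zs) y = R x z × Path z zs y

  SimplePath : Fin m → Fin m → Set
  SimplePath x y = ∃[ zs ] Unique (x ∷ zs) × Path x zs y

  suffix : ∀ {x z y} zs → Unique (z ∷ zs) → Path z zs y → x List.∈ (z ∷ zs) → SimplePath x y
  suffix zs       u       p       (here refl) = zs , u , p
  suffix (_ ∷ zs) (_ ∷ u) (_ , p) (there x∈)  = suffix zs u p x∈

  -- Loop erasure from the far end: a new first node that already occurs on the simple path replaces
  -- it by the suffix from that occurrence.
  simplify : ∀ {x y} → Star R x y → SimplePath x y
  simplify ε = [] , [] ∷ [] , refl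
  simplify {x} (_◅_ {j = z} r rs) with simplify rs
  ... | zs , u , p with x ∈ᴸ? (z ∷ zs)
  ...   | yes x∈ = suffix zs u p x∈
  ...   | no x∉  = z ∷ zs , ¬Any⇒All¬ _ x∉ ∷ u , r , p

  close : ∀ {S : Fin m → Fin m → Set} → (∀ {x y} → R x y → S x y) →
    ∀ {x y w} zs → Path x zs y → S y w → Linked S (x ∷ (zs ∷ʳ w))
  close R⇒S []       refl    s = s ∷ [-]
  close R⇒S (z ∷ zs) (r , p) s = R⇒S r ∷ close R⇒S zs p s

-- The two sides of a tree edge.

module TreeSides {m : ℕ} (G : Graph m) (isTree : IsTree G) where
  open Graph G renaming (sym to Adj-sym)
  open IsTree isTree

  Side : (s t : Fin m) → Fin m → Set
  Side s t = Star (AdjWithout s t) s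

  AdjWithout-sym : ∀ {s t x y} → AdjWithout s t x y → AdjWithout s t y x
  AdjWithout-sym (e , ≢st) =
    Adj-sym e , λ { (inj₁ (p , q)) → ≢st (inj₂ (q , p)) ; (inj₂ (p , q)) → ≢st (inj₁ (q , p)) }

  AdjWithout-swap : ∀ {s t x y} → AdjWithout s t x y → AdjWithout t s x y
  AdjWithout-swap (e , ≢st) = e , ≢st ∘ ⊎-swap

  Adj⇒≢ : ∀ {s t} → Adj s t → s ≢ t
  Adj⇒≢ e refl = irrefl _ e

  -- Take a simple path from `s` to `t` avoiding the edge. Length 0 contradicts irreflexivity,
  -- length 1 is the deleted edge, and anything longer closes up with the edge to a cycle.
  bridge : ∀ {s t} → Adj s t → ¬ Side s t t
  bridge {s} {t} e p with simplify p
    where open SimplePath (AdjWithout s t)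
  ... | []         , _ , refl               = irrefl _ e
  ... | _ ∷ []     , _ , (_ , ≢st) , refl   = ≢st (inj₁ (refl , refl))
  ... | x ∷ y ∷ zs , u , path               =
    acyclic s (x ∷ y ∷ zs) (s≤s (s≤s z≤n) , u , close proj₁ (x ∷ y ∷ zs) path (Adj-sym e))
    where open SimplePath (AdjWithout s t)

  sides-disjoint : ∀ {s t x} → Adj s t → Side s t x → ¬ Side t s x
  sides-disjoint e p q = bridge e (p ◅◅ reverse AdjWithout-sym (map AdjWithout-swap q))

  sides-cover : ∀ {s t} x → Side s t x ⊎ Side t s x
  sides-cover {s} {t} x = Star-preserves (λ y → Side s t y ⊎ Side t s y) step (inj₁ ε) (connected s x)
    where
    step : ∀ {y z} → Side s t y ⊎ Side t s y → Adj y z → Side s t z ⊎ Side t s z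
    -- Arriving at an endpoint restarts the walk there; an edge arriving elsewhere is not the
    -- deleted one, so it stays on the current side.
    step {y} {z} p e with z ≟ s | z ≟ t
    ... | yes refl | _        = inj₁ ε
    ... | _        | yes refl = inj₂ ε
    ... | no z≢s   | no z≢t   = ⊎-map (_◅◅ (e′ ◅ ε)) (_◅◅ (AdjWithout-swap e′ ◅ ε)) p
      where
      e′ : AdjWithout s t y z
      e′ = e , λ { (inj₁ (_ , z≡t)) → z≢t z≡t ; (inj₂ (_ , z≡s)) → z≢s z≡s }

  side? : ∀ {s t} → Adj s t → Decidable (Side s t)
  side? e x with sides-cover x
  ... | inj₁ p = yes p
  ... | inj₂ q = no λ p → sides-disjoint e p q

  -- By `bridge`, a walk from `a` that avoids the edge `at` never meets `t`, hence never uses the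
  -- edge `tb`; prefix it with the step from `t` to `a`. The invariant keeps both memberships for
  -- this reason.
  branch⊆side : ∀ {a b t x} → Adj a t → a ≢ b → Side a t x → Side t b x
  branch⊆side {a} {b} {t} {x} e a≢b p =
    proj₁ (Star-preserves (λ y → Side t b y × Side a t y) step (t⇝a ◅ ε , ε) p)
    where
    t⇝a : AdjWithout t b t a
    t⇝a = Adj-sym e , λ { (inj₁ (_ , a≡b)) → a≢b a≡b ; (inj₂ (_ , a≡t)) → Adj⇒≢ e a≡t }
    step : ∀ {y z} → Side t b y × Side a t y → AdjWithout a t y z → Side t b z × Side a t z
    step {y} {z} (q , r) e′ = q ◅◅ ((proj₁ e′ , avoids) ◅ ε) , r′
      where
      r′ = r ◅◅ (e′ ◅ ε)
      avoids : ¬ ((y ≡ t × z ≡ b) ⊎ (y ≡ b × z ≡ t))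
      avoids (inj₁ (refl , _)) = bridge e r
      avoids (inj₂ (_ , refl)) = bridge e r′

  branches-disjoint : ∀ {a b t x} → Adj a t → Adj b t → a ≢ b → Side a t x → ¬ Side b t x
  branches-disjoint e e′ a≢b p q = sides-disjoint e′ q (branch⊆side e a≢b p)

  branches-cover : ∀ t x → x ≡ t ⊎ ∃[ a ] Adj t a × Side a t x
  branches-cover t x = Star-preserves P step (inj₁ refl) (connected t x)
    where
    P : Fin m → Set
    P y = y ≡ t ⊎ ∃[ a ] Adj t a × Side a t y
    step : ∀ {y z} → P y → Adj y z → P z
    step (inj₁ refl) e = inj₂ (_ , e , ε)
    -- Each departure from `t` selects a new branch; an edge not touching `t` stays in the current
    -- one.
    step {y} {z} (inj₂ (a , e , p)) e′ with z ≟ t | y ≟ t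
    ... | yes z≡t | _        = inj₁ z≡t
    ... | no _    | yes refl = inj₂ (z , e′ , ε)
    ... | no z≢t  | no y≢t   =
      inj₂ (a , e , p ◅◅ ((e′ , λ { (inj₁ (_ , z≡t)) → z≢t z≡t ; (inj₂ (y≡t , _)) → y≢t y≡t }) ◅ ε))

  -- A first step away from `t` would have to use its only edge, which is deleted.
  leaf-side : ∀ {s t x} → Adj s t → degree t ≡ 1 → Side t s x → x ≡ t
  leaf-side _ _ ε = refl
  leaf-side {s} {t} e deg ((e′ , ≢ts) ◅ _) with ∣p∣≡1⇒singleton (nbrs t) deg
  ... | _ , _ , only = ⊥-elim (≢ts (inj₁ (refl , trans (only e′) (sym (only (Adj-sym e))))))

  component : ∀ {s t} → Adj s t → Σ[ N ∈ Subset m ] (∀ x → x ∈ N ⇔ Side s t x)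
  component e = comprehension (side? e)

  -- The measure for the walk counts nodes rather than elements of V: the node `t` left behind
  -- witnesses the strict decrease, though it may carry no element.
  ∣component∣ : ∀ {s t} → Adj s t → ℕ
  ∣component∣ e = ∣ proj₁ (component e) ∣

  component-shrinks : ∀ {u t s} (e : Adj u t) (e′ : Adj t s) → u ≢ s →
    ∣component∣ e < ∣component∣ e′
  component-shrinks {u} {t} {s} e e′ u≢s =
    p⊂q⇒∣p∣<∣q∣ ((λ {x} x∈ → from (char′ x) (branch⊆side e u≢s (to (char x) x∈))) ,
      t , from (char′ t) ε , bridge e ∘ to (char t))
    where
    char  = proj₂ (component e)
    char′ = proj₂ (component e′)

-- Submodularity and good sets.

module Goodness {n : ℕ} (f : Subset n → ℕ) (isConn : IsConnectivityFunction f)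
                (W : Subset n) where
  open IsConnectivityFunction isConn
  open ≤-Reasoning

  Good : Subset n → Set
  Good X = f (X ∩ W) < f W × f (X ∩ ∁ W) < f W

  good? : Decidable Good
  good? X = (f (X ∩ W) <? f W) ×-dec (f (X ∩ ∁ W) <? f W)

  f-∁∩∁ : ∀ X Y → f (∁ X ∩ ∁ Y) ≡ f (X ∪ Y)
  f-∁∩∁ X Y = trans (cong f (sym (deMorgan₂ X Y))) (sym (symmetric (X ∪ Y)))

  f-split : ∀ X Y → f Y ≤ f (X ∩ Y) + f (∁ X ∩ Y)
  f-split X Y = begin
    f Y                                                   ≡⟨ cong f Y≡ ⟩
    f ((X ∩ Y) ∪ (∁ X ∩ Y))                               ≤⟨ m≤m+n _ _ ⟩
    f ((X ∩ Y) ∪ (∁ X ∩ Y)) + f ((X ∩ Y) ∩ (∁ X ∩ Y))     ≤⟨ submodular _ _ ⟩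
    f (X ∩ Y) + f (∁ X ∩ Y)                               ∎
    where
    Y≡ : Y ≡ (X ∩ Y) ∪ (∁ X ∩ Y)
    Y≡ = trans (sym (∩-identityˡ Y))
      (trans (cong (_∩ Y) (sym (p∪∁p≡⊤ X))) (∩-distribʳ-∪ Y X (∁ X)))

  -- Submodularity for `X` and `Y` bounds `f (X ∪ Y)` by `f X`, since `f (X ∩ Y)` is at least `f Y`.
  -- Submodularity for `X` and `∁ Y` then gives the other bound, at the cost of a second `f X`;
  -- hence the factor 2.
  uncross : ∀ {X} Y → 2 * f X < f Y → f Y ≤ f (X ∩ Y) →
    f (∁ X ∩ Y) < f Y × f (∁ X ∩ ∁ Y) < f Y
  uncross {X} Y small bad = ≤-<-trans fst small , ≤-<-trans snd (≤-<-trans (m≤m+n _ _) small)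
    where
    snd : f (∁ X ∩ ∁ Y) ≤ f X
    snd = +-cancelʳ-≤ (f Y) _ _ (begin
      f (∁ X ∩ ∁ Y) + f Y       ≡⟨ cong (_+ f Y) (f-∁∩∁ X Y) ⟩
      f (X ∪ Y) + f Y           ≤⟨ +-monoʳ-≤ _ bad ⟩
      f (X ∪ Y) + f (X ∩ Y)     ≤⟨ submodular X Y ⟩
      f X + f Y                 ∎)
    fst : f (∁ X ∩ Y) ≤ 2 * f X
    fst = +-cancelʳ-≤ (f (X ∩ ∁ Y)) _ _ (begin
      f (∁ X ∩ Y) + f (X ∩ ∁ Y)        ≡⟨ cong (λ Z → f (∁ X ∩ Z) + f (X ∩ ∁ Y)) (sym (¬-involutive Y)) ⟩
      f (∁ X ∩ ∁ (∁ Y)) + f (X ∩ ∁ Y)  ≡⟨ cong (_+ f (X ∩ ∁ Y)) (f-∁∩∁ X (∁ Y)) ⟩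
      f (X ∪ ∁ Y) + f (X ∩ ∁ Y)        ≤⟨ submodular X (∁ Y) ⟩
      f X + f (∁ Y)                    ≤⟨ +-monoʳ-≤ (f X) (f-split X (∁ Y)) ⟩
      -- Of the two pieces of `∁ Y`, the one inside `X` is to be cancelled and the other was just
      -- bounded by `f X`.
      f X + (f (X ∩ ∁ Y) + f (∁ X ∩ ∁ Y)) ≤⟨ +-monoʳ-≤ (f X) (+-monoʳ-≤ (f (X ∩ ∁ Y)) snd) ⟩
      f X + (f (X ∩ ∁ Y) + f X)        ≡⟨ rearrange (f X) (f (X ∩ ∁ Y)) ⟩
      2 * f X + f (X ∩ ∁ Y)            ∎)
      where
      rearrange : ∀ a b → a + (b + a) ≡ 2 * a + b
      rearrange = solve-∀

  bad⇒∁-good : ∀ {X} → 2 * f X < f W → ¬ Good X → Good (∁ X)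
  bad⇒∁-good {X} small bad with f (X ∩ W) <? f W | f (X ∩ ∁ W) <? f W
  ... | yes p | yes q = contradiction (p , q) bad
  ... | no p  | _     = uncross W small (≮⇒≥ p)
  -- The same argument with `∁ W` in place of `W`, as both have the same `f`-value; the two bounds
  -- come out in the opposite order.
  ... | _     | no q
    with r , s ← uncross (∁ W) (subst (2 * f X <_) (symmetric W) small)
                   (subst (_≤ f (X ∩ ∁ W)) (symmetric W) (≮⇒≥ q)) =
    subst₂ _<_ (cong (λ Z → f (∁ X ∩ Z)) (¬-involutive W)) (sym (symmetric W)) s ,
    subst (f (∁ X ∩ ∁ W) <_) (sym (symmetric W)) r

  ⊥-good : 0 < f W → Good ⊥
  ⊥-good 0<fW = ⊥-case W , ⊥-case (∁ W)
    where
    ⊥-case : ∀ Y → f (⊥ ∩ Y) < f W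
    ⊥-case Y = subst (_< f W) (sym (trans (cong f (∩-zeroˡ Y)) f-⊥)) 0<fW

  -- Intersecting `X` with any set gives either `⊥` or `X` itself.
  subsingleton-good : ∀ {X} → 2 * f X < f W → (∀ {x y} → x ∈ X → y ∈ X → x ≡ y) → Good X
  subsingleton-good {X} small unique = part W , part (∁ W)
    where
    part : ∀ Y → f (X ∩ Y) < f W
    part Y with nonempty? (X ∩ Y)
    ... | no empty = subst (_< f W) (sym (trans (cong f (Empty-unique empty)) f-⊥)) (≤-<-trans z≤n small)
    ... | yes (x , x∈X∩Y) with x∈p∩q⁻ X Y x∈X∩Y
    ...   | x∈X , x∈Y =
      subst (λ Z → f Z < f W) (⊆-antisym X⊆X∩Y (p∩q⊆p X Y)) (≤-<-trans (m≤m+n _ _) small)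
      where
      X⊆X∩Y : X ⊆ X ∩ Y
      X⊆X∩Y y∈X = x∈p∩q⁺ (y∈X , subst (_∈ Y) (unique x∈X y∈X) x∈Y)

-- The walk in a branch decomposition.

module Walk {n : ℕ} (f : Subset n → ℕ) (isConn : IsConnectivityFunction f) (W : Subset n)
            (D : BranchDecomposition n)
            (narrow : ∀ {w} → BranchDecomposition.IsEdgeWidth D f w → 2 * w < f W) where
  open BranchDecomposition D renaming (sym to Adj-sym)
  open TreeSides T isTree
  open Goodness f isConn W

  side : ∀ {s t} → Adj s t → Σ[ X ∈ Subset n ] IsSide s t X
  side e = comprehension (side? e ∘ leafOf)

  side-unique : ∀ {s t X Y} → IsSide s t X → IsSide s t Y → X ≡ Y
  side-unique hX hY =
    ⊆-antisym (λ {v} → from (hY v) ∘ to (hX v)) (λ {v} → from (hX v) ∘ to (hY v))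

  opposite-side : ∀ {s t X} → Adj s t → IsSide s t X → IsSide t s (∁ X)
  opposite-side {s} {t} {X} e hX v = mk⇔
    (λ v∈∁X → [ (λ p → contradiction (from (hX v) p) (x∈∁p⇒x∉p v∈∁X)) , id ]′
                 (sides-cover (leafOf v)))
    (λ q → x∉p⇒x∈∁p λ v∈X → sides-disjoint e (to (hX v) v∈X) q)

  side-small : ∀ {s t X} → Adj s t → IsSide s t X → 2 * f X < f W
  side-small e hX = narrow (_ , _ , e , _ , hX , refl)

  leafOf-injective : ∀ {u v} → leafOf u ≡ leafOf v → u ≡ v
  leafOf-injective {u} {v} eq = Bijection.injective L (Leaf-≡ eq)
    where
    Leaf-≡ : ∀ {x y : Leaf} → proj₁ x ≡ proj₁ y → x ≡ y
    Leaf-≡ {_ , p} {_ , q} refl = cong (_ ,_) (≡-irrelevant p q)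

  leaf-side-good : ∀ {s t X} → Adj s t → degree t ≡ 1 → IsSide t s X → Good X
  leaf-side-good e deg hX = subsingleton-good (side-small (Adj-sym e) hX) λ {u} {v} u∈X v∈X →
    leafOf-injective (trans (leaf-side e deg (to (hX u) u∈X)) (sym (leaf-side e deg (to (hX v) v∈X))))

  Admissible : Subset n → Set
  Admissible C = 2 * f C < f W × Good C

  AdmissibleTripartition : Set
  AdmissibleTripartition = Σ[ P ∈ Tripartition n ] (∀ i → Admissible (Tripartition.part P i))

  GoodSide : (s t : Fin m) → Set
  GoodSide s t = ∃[ X ] IsSide s t X × Good X

  -- `check` may return a finished tripartition, found by walking on through a bad side; otherwise
  -- the three far sides are good and are the parts.
  degree-3-node : ∀ {t} → degree t ≡ 3 →
    (∀ {u} → Adj u t → AdmissibleTripartition ⊎ GoodSide u t) → AdmissibleTripartition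
  degree-3-node {t} deg check with ∣p∣≡3⇒triple (nbrs t) deg
  ... | a , b , c , (a∈ , b∈ , c∈) , (a≢b , a≢c , b≢c) , only
    with check (Adj-sym a∈) | check (Adj-sym b∈) | check (Adj-sym c∈)
  ... | inj₁ r | _ | _ = r
  ... | _ | inj₁ r | _ = r
  ... | _ | _ | inj₁ r = r
  ... | inj₂ (A , hA , gA) | inj₂ (B , hB , gB) | inj₂ (C , hC , gC) =
    mkTripartition A B C
      (λ {v} v∈A v∈B → branches-disjoint (Adj-sym a∈) (Adj-sym b∈) a≢b (to (hA v) v∈A) (to (hB v) v∈B))
      (λ {v} v∈A v∈C → branches-disjoint (Adj-sym a∈) (Adj-sym c∈) a≢c (to (hA v) v∈A) (to (hC v) v∈C))
      (λ {v} v∈B v∈C → branches-disjoint (Adj-sym b∈) (Adj-sym c∈) b≢c (to (hB v) v∈B) (to (hC v) v∈C))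
      cover {Admissible}
      (side-small (Adj-sym a∈) hA , gA) (side-small (Adj-sym b∈) hB , gB) (side-small (Adj-sym c∈) hC , gC)
    where
    cover : ∀ v → v ∈ A ⊎ v ∈ B ⊎ v ∈ C
    cover v with branches-cover t (leafOf v)
    -- An element placed at `t` would make `t` a leaf, of degree 1 and not 3.
    ... | inj₁ eq with trans (sym deg) (trans (cong degree (sym eq)) (proj₂ (Bijection.to L v)))
    ...   | ()
    cover v | inj₂ (u , e , p) with only e
    ... | inj₁ refl        = inj₁ (from (hA v) p)
    ... | inj₂ (inj₁ refl) = inj₂ (inj₁ (from (hB v) p))
    ... | inj₂ (inj₂ refl) = inj₂ (inj₂ (from (hC v) p))

  inspect-side : ∀ {u t} → Adj u t →
    (∀ {X} → IsSide u t X → ¬ Good X → AdmissibleTripartition) →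
    AdmissibleTripartition ⊎ GoodSide u t
  inspect-side e continue with side e
  ... | X , hX with good? X
  ...   | yes good = inj₂ (X , hX , good)
  ...   | no bad   = inj₁ (continue hX bad)

  -- The walk has just come from `s` to `t`, and `X` is the bad side entered.
  walk : ∀ {s t} (e : Adj t s) {X} → IsSide t s X → ¬ Good X →
    Acc _<_ (∣component∣ e) → AdmissibleTripartition
  walk {s} {t} e hX bad (acc rec) with degree-1-or-3 t
  ... | inj₁ deg = contradiction (leaf-side-good (Adj-sym e) deg hX) bad
  ... | inj₂ deg = degree-3-node deg check
    where
    check : ∀ {u} → Adj u t → AdmissibleTripartition ⊎ GoodSide u t
    check {u} e′ with u ≟ s
    -- Looking back along the edge just crossed, the far side is the complement of a bad side.
    ... | yes refl = inj₂ (_ , opposite-side e hX , bad⇒∁-good (side-small e hX) bad)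
    ... | no u≢s   = inspect-side e′ λ hY bad′ → walk e′ hY bad′ (rec (component-shrinks e′ e u≢s))

  walk-from : ∀ t → AdmissibleTripartition
  walk-from t with degree-1-or-3 t
  ... | inj₂ deg = degree-3-node deg (λ e → inspect-side e λ hX bad → walk e hX bad (<-wellFounded _))
  ... | inj₁ deg with ∣p∣≡1⇒singleton (nbrs t) deg
  ...   | u , e , _ with inspect-side (Adj-sym e) (λ hX bad → walk (Adj-sym e) hX bad (<-wellFounded _))
  ...     | inj₁ r               = r
  -- The start is a leaf whose edge has a good far side `X`; `∁ X` holds at most the element at that
  -- leaf. The part `⊥` needs `0 < f W`, which follows from `small`.
  ...     | inj₂ (X , hX , good) =
    mkTripartition X (∁ X) ⊥ x∈p⇒x∉∁p (λ _ → ∉⊥) (λ _ → ∉⊥) cover {Admissible}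
      (small , good)
      (side-small e h∁X , leaf-side-good (Adj-sym e) deg h∁X)
      (subst (λ k → 2 * k < f W) (sym f-⊥) 0<fW , ⊥-good 0<fW)
    where
    open IsConnectivityFunction isConn using (f-⊥)
    small : 2 * f X < f W
    small = side-small (Adj-sym e) hX
    0<fW : 0 < f W
    0<fW = ≤-<-trans z≤n small
    h∁X : IsSide t u (∁ X)
    h∁X = opposite-side (Adj-sym e) hX
    cover : ∀ v → v ∈ X ⊎ v ∈ ∁ X ⊎ v ∈ ⊥
    cover v with v ∈? X
    ... | yes v∈X = inj₁ v∈X
    ... | no v∉X  = inj₂ (inj₁ (x∉p⇒x∈∁p v∉X))

  admissibleTripartition : AdmissibleTripartition
  -- Any start node will do; a tree has at least one.
  admissibleTripartition = walk-from (fromℕ< (IsTree.nonempty isTree))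

theorem3 : ∀ {n : ℕ} (f : Subset n → ℕ) → IsConnectivityFunction f →
    ∀ (bw : ℕ) → IsBranchwidth f bw →
    ∀ (W : Subset n) → f W > 2 * bw →
    Σ[ P ∈ Tripartition n ]
    (∀ i → let C = Tripartition.part P i in
    2 * f C < f W × f (C ∩ W) < f W × f (C ∩ ∁ W) < f W)
-- `D` attains the branchwidth, so every edge width `w` satisfies `2 * w ≤ 2 * bw < f W`.
theorem3 f isConn bw ((D , _ , width≤bw) , _) W 2bw<fW =
  Walk.admissibleTripartition f isConn W D
    λ {w} isWidth → ≤-<-trans (*-monoʳ-≤ 2 (width≤bw w isWidth)) 2bw<fW
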